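{- Let $\Gamma$ be a $4$-regular infinite planar tessellation with non-negative combinatorial curvature. For $i=1,2$ let $\sigma_i$ be a face of degree $k_i\ge 8$, with $\sigma_1\ne\sigma_2$. Then $U_1(\sigma_1)\cap U_1(\sigma_2)=\emptyset$.
   Context: A planar tessellation is a locally finite, connected, simple graph embedded in $\mathbb S^2$ or $\mathbb R^2$, with faces the components of the complement, such that: (i) every closed face is a closed disk bounded by finitely many edges; (ii) every edge lies in exactly two different closed faces; (iii) two distinct closed faces intersect in the empty set, a single vertex, or the closure of a single edge; all vertex and face degrees (face degree = number of boundary edges) are at least $3$. Infinite means embedded in $\mathbb R^2$. The combinatorial curvature at a vertex $x$ is $\Phi(x)=1-\frac{|x|}{2}+\sum_{\sigma}\frac{1}{|\sigma|}$, summed over faces whose closure contains $x$; non-negative curvature means $\Phi\ge0$ at every vertex. $4$-regular means all vertices have degree $4$. For a face $\sigma$, $\partial\sigma$ is the set of vertices in the closure of $\sigma$, and the $1$-neighborhood is $U_1(\sigma)=\partial\sigma\cup\{x\in V: x\sim z\text{ for some }z\in\partial\sigma\}$, where $x\sim z$ means $x,z$ are adjacent. -}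

module Defs where

open import Data.Nat using (ℕ; zero; suc; _+_; _∸_; _≤_; _<_)
open import Data.Integer using (+_)
open import Data.Rational.Unnormalised using (ℚᵘ; mkℚᵘ; 0ℚᵘ; 1ℚᵘ)
  renaming (_+_ to _+q_; _-_ to _-q_; _≤_ to _≤q_)
open import Data.List using (List; []; _∷_; _++_)
open import Data.List.Membership.Propositional using (_∈_)
open import Data.Product using (Σ; ∃; _×_; _,_)
open import Data.Sum using (_⊎_)
open import Data.Empty using (⊥)
open import Relation.Nullary using (¬_)
open import Relation.Binary.PropositionalEquality using (_≡_; _≢_)
open import Relation.Binary.Construct.Closure.Equivalence using (EqClosure)

iter : {A : Set} → (A → A) → ℕ → A → A
iter f zero    x = x
iter f (suc n) x = f (iter f n x)

Period : {A : Set} → (A → A) → A → ℕ → Set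
Period f x k = (1 ≤ k) × (iter f k x ≡ x) × (∀ n → 1 ≤ n → n < k → iter f n x ≢ x)

orbitList : {A : Set} → (A → A) → A → ℕ → List A
orbitList f x zero    = []
orbitList f x (suc k) = x ∷ orbitList f (f x) k

-- Combinatorial maps (rotation systems).
-- Darts D; α d is the reverse dart; σ d is the next dart (in the cyclic
-- order given by the embedding) with the same origin vertex.
-- Vertex = σ-orbit (the origin of d), face = φ-orbit, φ = σ ∘ α.

record Map : Set₁ where
  field
    D : Set
    α : D → D
    σ : D → D

  φ : D → D
  φ d = σ (α d)

  SameVertex : D → D → Set
  SameVertex d e = ∃ λ n → iter σ n d ≡ e

  SameFace : D → D → Set
  SameFace d e = ∃ λ n → iter φ n d ≡ e

data Reach (M : Map) : Map.D M → Map.D M → Set where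
  here  : ∀ {d} → Reach M d d
  viaα  : ∀ {d e} → Reach M (Map.α M d) e → Reach M d e
  viaσ  : ∀ {d e} → Reach M (Map.σ M d) e → Reach M d e

module WalkDefs (M : Map) where
  open Map M

  IsWalk : List D → Set
  IsWalk []           = Data.Unit.⊤ where import Data.Unit
  IsWalk (d ∷ [])     = Data.Unit.⊤ where import Data.Unit
  IsWalk (d ∷ e ∷ w)  = SameVertex (α d) e × IsWalk (e ∷ w)

  lastOf : D → List D → D
  lastOf d []      = d
  lastOf d (e ∷ w) = lastOf e w

  ClosedWalk : List D → Set
  ClosedWalk []      = ⊥
  ClosedWalk (d ∷ w) = IsWalk (d ∷ w) × SameVertex (α (lastOf d w)) d

  data Step : List D → List D → Set where
    cancel : ∀ w₁ w₂ d → Step (w₁ ++ (d ∷ α d ∷ w₂)) (w₁ ++ w₂)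
    face   : ∀ w₁ w₂ x k → Period φ x k → Step (w₁ ++ (orbitList φ x k ++ w₂)) (w₁ ++ w₂)

  Homotopic : List D → List D → Set
  Homotopic = EqClosure Step

-- 1/n as an unnormalised rational (for n ≥ 1; mkℚᵘ p q denotes p/(q+1))
recip : ℕ → ℚᵘ
recip n = mkℚᵘ (+ 1) (n ∸ 1)

record Tessellation : Set₁ where
  field
    M : Map
  open Map M public
  open WalkDefs M public
  field
    α-invol   : ∀ d → α (α d) ≡ d
    α-nofix   : ∀ d → α d ≢ d
    vdeg      : D → ℕ
    vdeg-per  : ∀ d → Period σ d (vdeg d)
    fdeg      : D → ℕ
    fdeg-per  : ∀ d → Period φ d (fdeg d)
    vdeg≥3    : ∀ d → 3 ≤ vdeg d
    fdeg≥3    : ∀ d → 3 ≤ fdeg d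
    noLoop    : ∀ d → ¬ SameVertex d (α d)
    noMulti   : ∀ d e → SameVertex d e → SameVertex (α d) (α e) → d ≡ e
    connected : ∀ d e → Reach M d e
    -- the surface obtained by gluing discs into the faces is simply
    -- connected (hence, being a connected surface, a sphere or the plane)
    simplyConnected : ∀ w → ClosedWalk w → Homotopic w []
    -- (i) closed faces are closed discs: boundary cycle is simple
    faceSimple : ∀ d m n → m < fdeg d → n < fdeg d →
                 SameVertex (iter φ m d) (iter φ n d) → m ≡ n
    edgeTwoFaces : ∀ d → ¬ SameFace d (α d)

  InClosure : D → D → Set
  InClosure d v = ∃ λ x → SameFace d x × SameVertex x v

  Common : D → D → D → Set
  Common d e v = InClosure d v × InClosure e v

  field
    -- (iii) two distinct closed faces meet in ∅, a vertex, or a closed edge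
    faceMeet : ∀ d e → ¬ SameFace d e → ∀ u v → Common d e u → Common d e v →
               ¬ SameVertex u v →
               (∃ λ z → SameFace d z × SameFace e (α z) ×
                  ((SameVertex z u × SameVertex (α z) v) ⊎
                   (SameVertex z v × SameVertex (α z) u)))
               × (∀ w → Common d e w → SameVertex w u ⊎ SameVertex w v)

  cornerSum : ℕ → D → ℚᵘ
  cornerSum zero    d = 0ℚᵘ
  cornerSum (suc n) d = recip (fdeg d) +q cornerSum n (σ d)

  Φ : D → ℚᵘ
  Φ d = (1ℚᵘ -q mkℚᵘ (+ vdeg d) 1) +q cornerSum (vdeg d) d

  InU₁ : D → D → Set
  InU₁ d v = InClosure d v ⊎ (∃ λ z → InClosure d z × SameVertex (α z) v)

Infinite : Tessellation → Set
Infinite T = ¬ (Σ (List (Tessellation.D T)) λ l → ∀ d → d ∈ l)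

FourRegular : Tessellation → Set
FourRegular T = ∀ d → Tessellation.vdeg T d ≡ 4

NonNegCurv : Tessellation → Set
NonNegCurv T = ∀ d → 0ℚᵘ ≤q Tessellation.Φ T d

{-# OPTIONS --safe #-}
module Submission where

-- In a 4-regular tessellation of non-negative curvature the other three faces at a vertex of a face
-- of degree at least 8 are triangles, except that at most one of them may be a square.  In
-- particular two such faces P and Q share no vertex.  If their 1-neighbourhoods met, there would be
-- a short path from P to Q.  Since the faces next to P and Q are so restricted, the face following
-- the path leaves only a short list of possibilities for the next path, so the path can be pushed
-- once around P, and symmetrically around Q.  Each push shows that the neighbours of the vertices
-- next to P or Q lie in the union of the two 1-neighbourhoods.  This union is therefore closed under
-- adjacency, so by connectedness it is everything, although it is finite.

open import Defs
open import Data.Empty using (⊥; ⊥-elim)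
open import Data.Fin using (Fin; toℕ)
open import Data.Fin.Patterns using (0F; 1F; 2F; 3F)
open import Data.Integer using (+_; +≤+)
open import Data.Integer.Properties using (*-monoˡ-≤-nonNeg)
open import Data.List using (List; []; _∷_; _++_; map; applyUpTo; allFin; cartesianProductWith)
open import Data.List.Membership.Propositional using (_∈_)
open import Data.List.Membership.Propositional.Properties using (∈-++⁺ˡ; ∈-++⁺ʳ; ∈-map⁺; ∈-applyUpTo⁺; ∈-allFin; ∈-cartesianProductWith⁺)
open import Data.Nat using (ℕ; zero; suc; _+_; _≤_; _<_; s≤s)
open import Data.Nat.Properties using (_≟_; <-cmp; ≤∧≢⇒<; ≤-trans; ≤-reflexive; m≤n⇒m<n∨m≡n; m≤n+m; ∸-monoˡ-≤)
open import Data.Product using (Σ; ∃; _×_; _,_; proj₁; proj₂)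
open import Data.Rational.Unnormalised using (ℚᵘ; mkℚᵘ; 0ℚᵘ; 1ℚᵘ; *≤*) renaming (_+_ to _+q_; _-_ to _-q_; _≤_ to _≤q_)
import Data.Rational.Unnormalised.Properties as ℚ
open import Data.Rational.Unnormalised.Properties using () renaming (_≤?_ to _≤q?_)
open import Data.Sum using (_⊎_; inj₁; inj₂; [_,_]′) renaming (map to ⊎-map)
open import Relation.Binary.Definitions using (tri<; tri≈; tri>)
open import Relation.Binary.PropositionalEquality using (_≡_; refl; sym; trans; cong; subst)
open import Relation.Nullary using (¬_; yes; no)
open import Relation.Nullary.Decidable using (toWitnessFalse)

-- Words in the reversal and the rotation.

-- Words in the involution α (letter a) and the rotation σ of order 4 (letter s), acting from the
-- left on darts.  If d is the dart of a face at one of its corners, φ^n fixes d for n the face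
-- degree, so a face seen from eval w b contributes the stabiliser w⁻¹ φ^n w of b; all equations
-- between darts below are products of such stabilisers, checked by reduction of words.
data Word : Set where
  ε     : Word
  a_ s_ : Word → Word

infixr 20 a_ s_ s²_ s³_

s²_ s³_ : Word → Word
s² w = s s w
s³ w = s s s w

infixr 15 _·_
_·_ : Word → Word → Word
ε     · v = v
(a w) · v = a (w · v)
(s w) · v = s (w · v)

inverse : Word → Word
inverse ε     = ε
inverse (a w) = inverse w · a ε
inverse (s w) = inverse w · s³ ε

cancel-a : Word → Word
cancel-a (a w) = w
cancel-a w     = a w

cancel-s : Word → Word
cancel-s (s s s w) = w
cancel-s w         = s w

-- Gives the normal form in the free product of cyclic groups of orders 2 and 4, so that `refl`
-- decides equality of concrete words there.
reduce : Word → Word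
reduce ε     = ε
reduce (a w) = cancel-a (reduce w)
reduce (s w) = cancel-s (reduce w)

φ^ : ℕ → Word
φ^ zero    = ε
φ^ (suc n) = s a φ^ n

module Rotation {D : Set} (α σ : D → D)
  (α² : ∀ d → α (α d) ≡ d) (σ⁴ : ∀ d → iter σ 4 d ≡ d) where

  φ : D → D
  φ d = σ (α d)

  eval : Word → D → D
  eval ε     d = d
  eval (a w) d = α (eval w d)
  eval (s w) d = σ (eval w d)

  eval-· : ∀ w v d → eval (w · v) d ≡ eval w (eval v d)
  eval-· ε     v d = refl
  eval-· (a w) v d = cong α (eval-· w v d)
  eval-· (s w) v d = cong σ (eval-· w v d)

  eval-inverse : ∀ w d → eval (inverse w) (eval w d) ≡ d
  eval-inverse ε     d = refl
  eval-inverse (a w) d = trans (eval-· (inverse w) (a ε) _)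
    (trans (cong (eval (inverse w)) (α² _)) (eval-inverse w d))
  eval-inverse (s w) d = trans (eval-· (inverse w) (s³ ε) _)
    (trans (cong (eval (inverse w)) (σ⁴ _)) (eval-inverse w d))

  eval-cancel-a : ∀ w d → eval (cancel-a w) d ≡ α (eval w d)
  eval-cancel-a ε     d = refl
  eval-cancel-a (a w) d = sym (α² _)
  eval-cancel-a (s w) d = refl

  eval-cancel-s : ∀ w d → eval (cancel-s w) d ≡ σ (eval w d)
  eval-cancel-s (s s s w) d = sym (σ⁴ _)
  eval-cancel-s (s s a w) d = refl
  eval-cancel-s (s s ε)   d = refl
  eval-cancel-s (s a w)   d = refl
  eval-cancel-s (s ε)     d = refl
  eval-cancel-s (a w)     d = refl
  eval-cancel-s ε         d = refl

  eval-reduce : ∀ w d → eval (reduce w) d ≡ eval w d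
  eval-reduce ε     d = refl
  eval-reduce (a w) d = trans (eval-cancel-a (reduce w) d) (cong α (eval-reduce w d))
  eval-reduce (s w) d = trans (eval-cancel-s (reduce w) d) (cong σ (eval-reduce w d))

  Stabiliser : D → Set
  Stabiliser d = Σ Word λ w → eval w d ≡ d

  infix 30 _⁻¹
  _⁻¹ : ∀ {d} → Stabiliser d → Stabiliser d
  (w , p) ⁻¹ = inverse w , trans (cong (eval (inverse w)) (sym p)) (eval-inverse w _)

  product : ∀ {d} → List (Stabiliser d) → Word
  product []             = ε
  product ((w , _) ∷ rs) = w · product rs

  eval-product : ∀ {d} (rs : List (Stabiliser d)) → eval (product rs) d ≡ d
  eval-product []             = refl
  eval-product ((w , p) ∷ rs) =
    trans (eval-· w (product rs) _) (trans (cong (eval w) (eval-product rs)) p)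

  -- Every stabiliser fixes `d`, so their product may be appended to `u` on the right; what remains
  -- is an identity of words that `refl` settles at each use.
  via : ∀ {d} (rs : List (Stabiliser d)) u v → reduce (u · product rs) ≡ reduce v →
        eval u d ≡ eval v d
  via {d} rs u v eq =
    trans (cong (eval u) (sym (eval-product rs)))
    (trans (sym (eval-· u (product rs) d))
    (trans (sym (eval-reduce (u · product rs) d))
    (trans (cong (λ w → eval w d) eq) (eval-reduce v d))))

  rot : Fin 4 → D → D
  rot i = iter σ (toℕ i)

  unrot : ∀ i d → ∃ λ j → rot j (rot i d) ≡ d
  unrot 0F d = 0F , refl
  unrot 1F d = 3F , σ⁴ d
  unrot 2F d = 2F , σ⁴ d
  unrot 3F d = 1F , σ⁴ d

  spin : Fin 4 → Word → Word
  spin 0F w = w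
  spin 1F w = s w
  spin 2F w = s² w
  spin 3F w = s³ w

  eval-spin : ∀ i w d → eval (spin i w) d ≡ rot i (eval w d)
  eval-spin 0F w d = refl
  eval-spin 1F w d = refl
  eval-spin 2F w d = refl
  eval-spin 3F w d = refl

  -- Neighbourhoods of a set of faces, in terms of darts.

  module Neighbourhood (K : D → Set) where

    Meets : D → Set
    Meets d = ∃ λ i → K (rot i d)

    -- The 1-neighbourhood of the faces in `K`, with a vertex represented by any of its darts.
    -- Indices in `Fin 4` keep the later case analyses and lists finite.
    data Near (d : D) : Set where
      on     : Meets d → Near d
      beside : ∀ i → Meets (α (rot i d)) → Near d

    record Enclosed (d : D) : Set where
      constructor enclose
      field near : ∀ i → Near (α (rot i d))
    open Enclosed public

    enclosed : ∀ {d} → Near (α d) → Near (α (σ d)) → Near (α (iter σ 2 d)) →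
               Near (α (iter σ 3 d)) → Enclosed d
    enclosed n₀ n₁ n₂ n₃ = enclose λ { 0F → n₀ ; 1F → n₁ ; 2F → n₂ ; 3F → n₃ }

    enclosed-σ : ∀ {d} → Enclosed d → Enclosed (σ d)
    enclosed-σ {d} e = enclosed (near e 1F) (near e 2F) (near e 3F)
      (subst (λ x → Near (α x)) (sym (σ⁴ d)) (near e 0F))

    meets-σ : ∀ {d} → Meets d → Meets (σ d)
    meets-σ {d} (0F , k) = 3F , subst K (sym (σ⁴ d)) k
    meets-σ     (1F , k) = 0F , k
    meets-σ     (2F , k) = 1F , k
    meets-σ     (3F , k) = 2F , k

    meets-iter : ∀ {d} n → Meets d → Meets (iter σ n d)
    meets-iter zero    m = m
    meets-iter (suc n) m = meets-σ (meets-iter n m)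

    meets⇒enclosed : ∀ {d} → Meets d → Enclosed d
    meets⇒enclosed {d} m = enclose λ i →
      beside 0F (subst Meets (sym (α² (rot i d))) (meets-iter (toℕ i) m))

    near-σ : ∀ {d} → Near d → Near (σ d)
    near-σ     (on m)        = on (meets-σ m)
    near-σ {d} (beside 0F m) = beside 3F (subst (λ x → Meets (α x)) (sym (σ⁴ d)) m)
    near-σ     (beside 1F m) = beside 0F m
    near-σ     (beside 2F m) = beside 1F m
    near-σ     (beside 3F m) = beside 2F m

    near-iter : ∀ {d} n → Near d → Near (iter σ n d)
    near-iter zero    m = m
    near-iter (suc n) m = near-σ (near-iter n m)

    meets⇒near-α : ∀ {d} → Meets d → Near (α d)
    meets⇒near-α {d} m = beside 0F (subst Meets (sym (α² d)) m)

    module _ (next : ∀ {d} → K d → K (φ d)) (prev : ∀ {d} → K d → K (α (iter σ 3 d)))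
      (encl : ∀ {d} → K d → Enclosed (α (σ d)) × Enclosed (α (iter σ 2 d))) where

      private
        enclosed-across : ∀ {d} i → Enclosed (α (α (rot i d))) → Near (α d)
        enclosed-across {d} i e = let (j , eq) = unrot i d in
          subst (λ x → Near (α x)) (trans (cong (rot j) (α² _)) eq) (near e j)

        meets-across : ∀ {d} i → Meets (rot i d) → Meets d
        meets-across {d} i m = let (j , eq) = unrot i d in
          subst Meets eq (meets-iter (toℕ j) m)

      -- Seen from the corner of `K` at the far end, the connecting edge is one of four. Two of them
      -- run along the face, so the origin of `d` already lies on it; the other two lead outwards,
      -- and there `encl` puts all neighbours of that origin near `K`.
      near-α : ∀ {d} → Near d → Near (α d)
      near-α (on m) = meets⇒near-α m
      near-α (beside i (0F , k)) = meets⇒near-α (meets-across i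
        (1F , subst (λ x → K (σ x)) (α² _) (next k)))
      near-α (beside i (1F , k)) = meets⇒near-α (meets-across i
        (0F , subst K (trans (cong α (σ⁴ _)) (α² _)) (prev k)))
      near-α (beside i (2F , k)) = enclosed-across i
        (subst (λ x → Enclosed (α x)) (σ⁴ _) (proj₂ (encl k)))
      near-α (beside i (3F , k)) = enclosed-across i
        (subst (λ x → Enclosed (α x)) (σ⁴ _) (proj₁ (encl k)))

  -- Stabilisers from face degrees, and large faces.

  module Degrees (deg : D → ℕ) (deg-φ : ∀ d → deg (φ d) ≡ deg d)
    (closes : ∀ d → eval (φ^ (deg d)) d ≡ d) where

    private
      conj : ∀ {d n} w → deg (eval w d) ≡ n → Stabiliser d
      conj {d} {n} w p = inverse w · φ^ n · w ,
        trans (eval-· (inverse w) (φ^ n · w) d)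
        (trans (cong (eval (inverse w)) (trans (eval-· (φ^ n) w d)
          (subst (λ k → eval (φ^ k) (eval w d) ≡ eval w d) p (closes (eval w d)))))
        (eval-inverse w d))

    tri : ∀ {d} w → deg (eval w d) ≡ 3 → Stabiliser d
    tri = conj

    sqr : ∀ {d} w → deg (eval w d) ≡ 4 → Stabiliser d
    sqr = conj

    deg-φ^ : ∀ n d → deg (eval (φ^ n) d) ≡ deg d
    deg-φ^ zero    d = refl
    deg-φ^ (suc n) d = trans (deg-φ _) (deg-φ^ n d)

    -- Transfers a degree between two corners of one face, for instance from the end of a path on
    -- `P` to its end on `Q`.
    same-face : ∀ {d} (rs : List (Stabiliser d)) n u v →
      reduce ((φ^ n · u) · product rs) ≡ reduce v → deg (eval v d) ≡ deg (eval u d)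
    same-face {d} rs n u v eq =
      trans (cong deg (sym (via rs (φ^ n · u) v eq)))
      (trans (cong deg (eval-· (φ^ n) u d)) (deg-φ^ n (eval u d)))

    -- All that is kept of the curvature condition. At a dart `d` of the face, corner 1 is the face
    -- across `d`, corner 3 the face across the preceding edge, and corner 2 the opposite face.
    record LargeFace (P : D → Set) : Set where
      field
        next : ∀ {d} → P d → P (φ d)
        prev : ∀ {d} → P d → P (α (iter σ 3 d))
        orbit : ∀ {d e} → P d → P e → ∃ λ n → iter φ (suc n) d ≡ e
        corner₁ : ∀ {d} → P d → deg (σ d) ≡ 3 ⊎ deg (σ d) ≡ 4
        corner₂ : ∀ {d} → P d → deg (iter σ 2 d) ≡ 3 ⊎ deg (iter σ 2 d) ≡ 4
        corner₃ : ∀ {d} → P d → deg (iter σ 3 d) ≡ 3 ⊎ deg (iter σ 3 d) ≡ 4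
        others₁ : ∀ {d} → P d → deg (σ d) ≡ 4 → deg (iter σ 2 d) ≡ 3 × deg (iter σ 3 d) ≡ 3
        others₂ : ∀ {d} → P d → deg (iter σ 2 d) ≡ 4 → deg (σ d) ≡ 3 × deg (iter σ 3 d) ≡ 3
        others₃ : ∀ {d} → P d → deg (iter σ 3 d) ≡ 4 → deg (σ d) ≡ 3 × deg (iter σ 2 d) ≡ 3

    -- Sweeping a path through the annulus between two large faces.

    module Strip {P Q K : D → Set} (largeP : LargeFace P) (largeQ : LargeFace Q)
      (P⊆K : ∀ {d} → P d → K d) (Q⊆K : ∀ {d} → Q d → K d)
      (disjoint : ∀ {d} i j → Q (rot i d) → ¬ P (rot j d)) where

      open Neighbourhood K

      private
        module P = LargeFace largeP
        module Q = LargeFace largeQ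

      -- The annulus between the two faces is swept along P.  A state at the dart b of P is a
      -- path across the annulus from the origin of b to a vertex of Q, given by the word that
      -- sends b to the dart c of Q at its end.  The recorded triangles lie ahead of the path, at
      -- ends whose square already lies behind it.  Subscripts count the edges ahead of the path: at
      -- its two ends for an edge, at its inner vertices for a longer path.
      data State (b : D) : Set where
        edge₀₁   : Q (eval (s³ a s ε) b) → State b
        edge₁₀   : Q (eval (s² a s² ε) b) → State b
        edge₀₀   : Q (eval (s² a s ε) b) → State b
        path₂₀   : Q (eval (s³ a s a s³ a s ε) b) → deg (σ b) ≡ 3 → State b
        path₀₂   : Q (eval (s² a s³ a s a s² ε) b) →
                   deg (eval (s³ s² a s³ a s a s² ε) b) ≡ 3 → State b
        path₂    : Q (eval (s² a s³ a s ε) b) → deg (σ b) ≡ 3 →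
                   deg (eval (s³ s² a s³ a s ε) b) ≡ 3 → State b

      -- The two enclosed vertices are the far ends of the edges that the face across `b` has at the
      -- two ends of `b`. One turn around `P` thus treats both outward edges at every corner.
      Step : D → Set
      Step b = State (φ b) × Enclosed (α (σ b)) × Enclosed (α (iter σ 2 (φ b)))

      private
        module At (b : D) where

          pass : ∀ (X : D → Set) (rs : List (Stabiliser b)) u v →
                 reduce (u · product rs) ≡ reduce v → X (eval u b) → X (eval v b)
          pass X rs u v eq = subst X (via rs u v eq)

          -- The relations would identify a vertex of `Q` with one of `P`; `i` is the rotation
          -- between their corners.
          clash : ∀ (rs : List (Stabiliser b)) u v i → reduce (spin i u · product rs) ≡ reduce v →
                  Q (eval u b) → P (eval v b) → ⊥
          clash rs u v i eq q p = disjoint 0F i q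
            (subst P (sym (trans (sym (eval-spin i u b)) (via rs (spin i u) v eq))) p)

          meets : ∀ (rs : List (Stabiliser b)) x k i →
                reduce (spin i x · product rs) ≡ reduce k → K (eval k b) → Near (eval x b)
          meets rs x k i eq p = on (i ,
            subst K (sym (trans (sym (eval-spin i x b)) (via rs (spin i x) k eq))) p)

          adjoins : ∀ (rs : List (Stabiliser b)) x k i j →
                reduce (spin j (a spin i x) · product rs) ≡ reduce k →
                K (eval k b) → Near (eval x b)
          adjoins rs x k i j eq p = beside i (j ,
            subst K (sym (trans (sym (trans (eval-spin j (a spin i x) b)
              (cong (λ d → rot j (α d)) (eval-spin i x b))))
              (via rs (spin j (a spin i x)) k eq))) p)

          -- When the face across b is a triangle, b and its successor share its apex.
          share-apex : deg (σ b) ≡ 3 → Enclosed (α (σ b)) → Enclosed (α (iter σ 2 (φ b)))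
          share-apex t e = subst Enclosed (via (tri (s ε) t ⁻¹ ∷ []) (s a s ε) (a s² s a ε) refl)
            (enclosed-σ e)

          step₀₁ : P b → Q (eval (s³ a s ε) b) → Step b
          step₀₁ p q with P.corner₁ p
          ... | inj₁ t =
            edge₁₀ (pass Q (tri (s ε) t ⁻¹ ∷ []) (s³ a s ε) (s² a s² s a ε) refl q) , encl ,
            share-apex t encl
            where
            encl : Enclosed (α (σ b))
            encl = meets⇒enclosed (3F , Q⊆K q)
          -- The square has one further vertex, the far end of `s² b′`. The triangles next to the
          -- square, forced at both large faces, determine all neighbours of this vertex, and the
          -- new path passes through it.
          ... | inj₂ f =
            path₂₀ (pass Q (tri (s³ c) t₃ ⁻¹ ∷ sqr (s ε) f ⁻¹ ∷ tri (s² b′) t′₂ ⁻¹ ∷ [])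
                     (a s³ c) (s³ a s a s³ a s b′) refl q′)
                   (proj₁ (P.others₃ p′ f′)) ,
            meets⇒enclosed (3F , Q⊆K q) ,
            enclosed
              (meets [] (a a s² b′) b′ 2F refl (P⊆K p′))
              (adjoins (tri (s² b′) t′₂ ⁻¹ ∷ []) (a s a s² b′) b′ 1F 3F refl (P⊆K p′))
              (meets (sqr (s ε) f ∷ tri (s³ c) t₃ ∷ []) (a s² a s² b′) (a s³ c) 3F refl (Q⊆K q′))
              (meets (sqr (s ε) f ∷ []) (a s³ a s² b′) c 2F refl (Q⊆K q))
            where
            b′ = s a ε
            c = s³ a s ε
            p′ = P.next p
            q′ = Q.prev q
            t₃ = proj₂ (Q.others₂ q (trans (same-face [] 1 (s ε) (s² c) refl) f))
            f′ = trans (sym (same-face [] 1 (s³ b′) (s ε) refl)) f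
            t′₂ = proj₂ (P.others₃ p′ f′)

          step₂₀ : P b → Q (eval (s³ a s a s³ a s ε) b) → deg (σ b) ≡ 3 → Step b
          step₂₀ p q t with Q.corner₂ q
          ... | inj₁ t₂ = go (P.corner₂ p′) , encl , share-apex t encl
            where
            b′ = s a ε
            c = s³ a s a s³ a s ε
            p′ = P.next p
            q′ = Q.prev q
            go : deg (eval (s² b′) b) ≡ 3 ⊎ deg (eval (s² b′) b) ≡ 4 → State (φ b)
            -- With a triangle here, the edge of `Q` ahead at the end of the path would lead to the
            -- origin of `b′`, which lies on `P`.
            go (inj₁ t′) = ⊥-elim (clash
              (tri (s² c) t₂ ⁻¹ ∷ tri (s ε) t ⁻¹ ∷ tri (s² b′) t′ ⁻¹ ∷ []) (a s³ c) b′ 3F refl q′ p′)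
            go (inj₂ f′) = edge₀₁ (pass Q
              (tri (s² c) t₂ ⁻¹ ∷ tri (s ε) t ⁻¹ ∷ sqr (s² b′) f′ ⁻¹ ∷ [])
              (a s³ c) (s³ a s b′) refl q′)
            encl : Enclosed (α (σ b))
            encl = enclosed
              (meets [] (a a s ε) ε 3F refl (P⊆K p))
              (meets (tri (s ε) t ⁻¹ ∷ []) (a s a s ε) b′ 2F refl (P⊆K p′))
              (meets (tri (s² c) t₂ ∷ []) (a s² a s ε) c 2F refl (Q⊆K q))
              (adjoins [] (a s³ a s ε) c 1F 3F refl (Q⊆K q))
          ... | inj₂ f₂ =
            path₀₂ (pass Q rs c c₁ refl q)
                   (pass (λ d → deg d ≡ 3) rs (s³ c) (s³ c₁) refl (proj₂ (Q.others₂ q f₂))) ,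
            encl , share-apex t encl
            where
            b′ = s a ε
            c = s³ a s a s³ a s ε
            c₁ = s² a s³ a s a s² b′
            p′ = P.next p
            rs = sqr (s² c) f₂ ⁻¹ ∷ tri (s ε) t ⁻¹ ∷ []
            encl : Enclosed (α (σ b))
            encl = enclosed
              (meets [] (a a s ε) ε 3F refl (P⊆K p))
              (meets (tri (s ε) t ⁻¹ ∷ []) (a s a s ε) b′ 2F refl (P⊆K p′))
              (adjoins (sqr (s² c) f₂ ∷ []) (a s² a s ε) c 3F 2F refl (Q⊆K q))
              (adjoins [] (a s³ a s ε) c 1F 3F refl (Q⊆K q))

          step₁₀ : P b → Q (eval (s² a s² ε) b) → Step b
          step₁₀ p q with P.corner₂ p
          -- The face ahead has no edge of `P` at `b`. Crossing this triangle only turns the path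
          -- about the origin of `b`, so a second move is made at the same dart.
          ... | inj₁ t = step₀₁ p (pass Q (tri (s² ε) t ⁻¹ ∷ []) (a s³ s² a s² ε) (s³ a s ε) refl (Q.prev q))
          ... | inj₂ f =
            path₀₂ (pass Q rs c′ c₁ refl q′)
                   (pass (λ d → deg d ≡ 3) rs (s³ c′) (s³ c₁) refl (proj₂ (Q.others₁ q′ f′₁))) ,
            encl , share-apex t₁ encl
            where
            b′ = s a ε
            c′ = a s³ s² a s² ε
            c₁ = s² a s³ a s a s² b′
            p′ = P.next p
            q′ = Q.prev q
            t₁ = proj₁ (P.others₂ p f)
            f′₁ = trans (same-face [] 2 (s² ε) (s c′) refl) f
            t′₂ = proj₁ (Q.others₁ q′ f′₁)
            rs = tri (s² c′) t′₂ ⁻¹ ∷ sqr (s² ε) f ⁻¹ ∷ tri (s ε) t₁ ⁻¹ ∷ []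
            encl : Enclosed (α (σ b))
            encl = enclosed
              (meets [] (a a s ε) ε 3F refl (P⊆K p))
              (meets (tri (s ε) t₁ ⁻¹ ∷ []) (a s a s ε) b′ 2F refl (P⊆K p′))
              (adjoins (sqr (s² ε) f ∷ tri (s² c′) t′₂ ∷ []) (a s² a s ε) c′ 3F 2F refl (Q⊆K q′))
              (meets (sqr (s² ε) f ∷ []) (a s³ a s ε) c′ 3F refl (Q⊆K q′))

          step₀₂ : P b → Q (eval (s² a s³ a s a s² ε) b) →
                   deg (eval (s³ s² a s³ a s a s² ε) b) ≡ 3 → Step b
          step₀₂ p q t₃ with P.corner₂ p
          -- Again the path first moves across a face without leaving the origin of `b`.
          ... | inj₂ f = step₂₀ p
            (pass Q (tri (s³ c) t₃ ⁻¹ ∷ sqr (s² ε) f ⁻¹ ∷ []) (a s³ c) (s³ a s a s³ a s ε) refl (Q.prev q))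
            (proj₁ (P.others₂ p f))
            where
            c = s² a s³ a s a s² ε
          ... | inj₁ t = go (P.corner₁ p)
            where
            b′ = s a ε
            c = s² a s³ a s a s² ε
            p′ = P.next p
            q′ = Q.prev q
            go : deg (σ b) ≡ 3 ⊎ deg (σ b) ≡ 4 → Step b
            go (inj₁ t₁) = ⊥-elim (clash
              (tri (s³ c) t₃ ⁻¹ ∷ tri (s² ε) t ⁻¹ ∷ tri (s ε) t₁ ⁻¹ ∷ []) (a s³ c) b′ 3F refl q′ p′)
            go (inj₂ f₁) = edge₁₀ q₁ ,
              enclosed
                (meets [] (a a s ε) ε 3F refl (P⊆K p))
                (meets (tri (s² ε) t ∷ tri (s³ c) t₃ ∷ []) (a s a s ε) (a s³ c) 3F refl (Q⊆K q′))
                (meets (tri (s² ε) t ∷ []) (a s² a s ε) c 2F refl (Q⊆K q))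
                (adjoins (tri (s² ε) t ∷ []) (a s³ a s ε) ε 3F 2F refl (P⊆K p)) ,
              meets⇒enclosed (2F , Q⊆K q₁)
              where
              q₁ : Q (eval (s² a s² b′) b)
              q₁ = pass Q (tri (s³ c) t₃ ⁻¹ ∷ tri (s² ε) t ⁻¹ ∷ sqr (s ε) f₁ ⁻¹ ∷ [])
                (a s³ c) (s² a s² b′) refl q′

          step₀₀ : P b → Q (eval (s² a s ε) b) → Step b
          step₀₀ p q with P.corner₁ p
          -- The face ahead contains an edge of `P` and an edge of `Q` on either side of the path,
          -- so as a triangle it would make them meet.
          ... | inj₁ t = ⊥-elim (clash (tri (s ε) t ⁻¹ ∷ []) (a s³ s² a s ε) (s a ε) 2F refl
                           (Q.prev q) (P.next p))
          ... | inj₂ f =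
            -- The far side of the square has one edge ahead at each end, which is not a state; the
            -- path is therefore pushed on over the triangle that follows it.
            path₂ (pass Q rs c′ c₁ refl q′) (proj₁ (P.others₃ p′ f′₃))
                  (pass (λ d → deg d ≡ 3) rs (s³ c′) (s³ c₁) refl
                    (proj₂ (Q.others₁ q′ (trans (same-face [] 2 (s ε) (s c′) refl) f)))) ,
            meets⇒enclosed (2F , Q⊆K q) ,
            meets⇒enclosed (3F , Q⊆K (pass Q (sqr (s ε) f ⁻¹ ∷ []) c′ (s³ a s² b′) refl q′))
            where
            b′ = s a ε
            c′ = a s³ s² a s ε
            c₁ = s² a s³ a s b′
            p′ = P.next p
            q′ = Q.prev q
            f′₃ = trans (sym (same-face [] 1 (s³ b′) (s ε) refl)) f
            rs = sqr (s ε) f ⁻¹ ∷ tri (s² b′) (proj₂ (P.others₃ p′ f′₃)) ⁻¹ ∷ []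

          -- Three faces lie ahead at the inner vertex. The recorded triangles are the outer two and
          -- join it to the next vertices of `P` and `Q`; only the degree of the middle one is open.
          step₂ : P b → Q (eval (s² a s³ a s ε) b) → deg (σ b) ≡ 3 →
                  deg (eval (s³ s² a s³ a s ε) b) ≡ 3 → Step b
          step₂ p q t t₃ = go (P.corner₂ p′) , encl , share-apex t encl
            where
            b′ = s a ε
            c = s² a s³ a s ε
            c′ = a s³ c
            c₁ = s² a s³ a s b′
            p′ = P.next p
            q′ = Q.prev q
            go : deg (eval (s² b′) b) ≡ 3 ⊎ deg (eval (s² b′) b) ≡ 4 → State (φ b)
            go (inj₁ t′) = edge₀₀ (pass Q
              (tri (s³ c) t₃ ⁻¹ ∷ tri (s ε) t ⁻¹ ∷ tri (s² b′) t′ ⁻¹ ∷ []) c′ (s² a s b′) refl q′)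
            go (inj₂ f′) = path₂ (pass Q rs c′ c₁ refl q′) (proj₁ (P.others₂ p′ f′))
              (pass (λ d → deg d ≡ 3) rs (s³ c′) (s³ c₁) refl (proj₂ (Q.others₂ q′
                (trans (same-face (tri (s ε) t ∷ tri (s³ c) t₃ ∷ []) 2 (s² b′) (s² c′) refl) f′))))
              where
              rs = tri (s³ c) t₃ ⁻¹ ∷ tri (s ε) t ⁻¹ ∷ sqr (s² b′) f′ ⁻¹ ∷ []
            encl : Enclosed (α (σ b))
            encl = enclosed
              (meets [] (a a s ε) ε 3F refl (P⊆K p))
              (meets (tri (s ε) t ⁻¹ ∷ []) (a s a s ε) b′ 2F refl (P⊆K p′))
              (meets (tri (s³ c) t₃ ∷ []) (a s² a s ε) c′ 3F refl (Q⊆K q′))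
              (meets [] (a s³ a s ε) c 2F refl (Q⊆K q))

      step : ∀ {b} → P b → State b → Step b
      step {b} p (edge₀₁ q)     = At.step₀₁ b p q
      step {b} p (edge₁₀ q)     = At.step₁₀ b p q
      step {b} p (edge₀₀ q)     = At.step₀₀ b p q
      step {b} p (path₂₀ q t)   = At.step₂₀ b p q t
      step {b} p (path₀₂ q t)   = At.step₀₂ b p q t
      step {b} p (path₂ q t t₃) = At.step₂ b p q t t₃

      -- From a common vertex of the 1-neighbourhoods to a state.

      Linked : Set
      Linked = ∃ λ b → P b × State b

      -- Edges running along `P` or `Q` contradict disjointness. Four positions remain, of which
      -- three are states.
      edge⇒linked : ∀ {b} → P b → ∀ n l → Q (rot l (α (rot n b))) → Linked
      edge⇒linked {b} p 0F l q = ⊥-elim (disjoint l 1F q (P.next p))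
      edge⇒linked {b} p 3F l q = ⊥-elim (disjoint l 0F q (P.prev p))
      edge⇒linked {b} p 1F 0F q = ⊥-elim (disjoint {b} 2F 0F (subst (λ d → Q (σ d)) (α² _) (Q.next q)) p)
      edge⇒linked {b} p 2F 0F q = ⊥-elim (disjoint {b} 3F 0F (subst (λ d → Q (σ d)) (α² _) (Q.next q)) p)
      edge⇒linked {b} p 1F 1F q = ⊥-elim (disjoint {b} 1F 0F
        (At.pass b Q [] (a s³ s a s ε) (s ε) refl (Q.prev q)) p)
      edge⇒linked {b} p 2F 1F q = ⊥-elim (disjoint {b} 2F 0F
        (At.pass b Q [] (a s³ s a s² ε) (s² ε) refl (Q.prev q)) p)
      edge⇒linked {b} p 1F 2F q = b , p , edge₀₀ q
      edge⇒linked {b} p 1F 3F q = b , p , edge₀₁ q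
      edge⇒linked {b} p 2F 2F q = b , p , edge₁₀ q
      -- No edge lies behind this one at either end, so the face behind it has an edge on each large
      -- face. It must be a square, and its opposite side is a state.
      edge⇒linked {b} p 2F 3F q with P.corner₃ p
      ... | inj₁ t = ⊥-elim (clash (tri (s³ ε) t ∷ []) (s a s³ a s² ε) (a s³ ε) 2F refl
                       (Q.next q) (P.prev p))
        where open At b
      ... | inj₂ f = α (iter σ 3 b) , P.prev p , edge₀₀
          (pass Q (sqr (s³ ε) f ∷ []) (s a s³ a s² ε) (s² a s a s³ ε) refl (Q.next q))
        where open At b

      private
        -- pathₙₘₗ treats a path from b through a single vertex outside P and Q, where n, m, l are
        -- the numbers of rotations at its three vertices.
        module AtPath (b : D) (p : P b) where
          open At b

          b′ b₋ : Word
          b′ = s a ε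
          b₋ = a s³ ε

          p′ : P (eval b′ b)
          p′ = P.next p

          p₋ : P (eval b₋ b)
          p₋ = P.prev p

          Joined : Word → Set
          Joined c = Q (eval c b) → Linked

          path₁₁₂ : Joined (s² a s a s ε)
          path₁₁₂ q with P.corner₁ p
          ... | inj₁ t = ⊥-elim (clash (tri (s ε) t ⁻¹ ∷ []) (s² a s a s ε) b′ 0F refl q p′)
          ... | inj₂ f = ⊥-elim (clash (sqr (s ε) f ⁻¹ ∷ []) (a s³ s² a s a s ε) b′ 2F refl (Q.prev q) p′)

          path₁₁₃ : Joined (s³ a s a s ε)
          path₁₁₃ q with P.corner₁ p
          ... | inj₁ t = ⊥-elim (clash (tri (s ε) t ⁻¹ ∷ []) (s³ a s a s ε) b′ 3F refl q p′)
          ... | inj₂ f = edge⇒linked p′ 2F 2F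
            (pass Q (sqr (s ε) f ⁻¹ ∷ []) (s³ a s a s ε) (s² a s² b′) refl q)

          path₂₁₂ : Joined (s² a s a s² ε)
          path₂₁₂ q with P.corner₂ p
          ... | inj₁ t = ⊥-elim (clash (tri (s² ε) t ⁻¹ ∷ []) (a s³ s² a s a s² ε) ε 3F refl (Q.prev q) p)
          ... | inj₂ f = edge⇒linked p 1F 3F
            (pass Q (sqr (s² ε) f ⁻¹ ∷ []) (a s³ s² a s a s² ε) (s³ a s ε) refl (Q.prev q))

          path₂₁₃ : Joined (s³ a s a s² ε)
          path₂₁₃ q with P.corner₂ p
          ... | inj₁ t = edge⇒linked p 1F 2F
            (pass Q (tri (s² ε) t ⁻¹ ∷ []) (s³ a s a s² ε) (s² a s ε) refl q)
          ... | inj₂ f = b , p , path₂ (pass Q rs c c₁ refl q) (proj₁ (P.others₂ p f))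
              (pass (λ d → deg d ≡ 3) rs (s³ c) (s³ c₁) refl
                (proj₂ (Q.others₂ q (trans (same-face [] 2 (s² ε) (s² c) refl) f))))
            where
            c = s³ a s a s² ε
            c₁ = s² a s³ a s ε
            rs = sqr (s² ε) f ⁻¹ ∷ []

          path₂₃₃ : Joined (s³ a s³ a s² ε)
          path₂₃₃ q with P.corner₃ p
          ... | inj₁ t = ⊥-elim (clash (tri (s³ ε) t ∷ []) (s³ a s³ a s² ε) b₋ 0F refl q p₋)
          ... | inj₂ f = ⊥-elim (clash (sqr (s³ ε) f ∷ []) (s a s³ a s³ a s² ε) b₋ 2F refl (Q.next q) p₋)

          path₂₃₂ : Joined (s² a s³ a s² ε)
          path₂₃₂ q with P.corner₃ p
          ... | inj₁ t = ⊥-elim (clash (tri (s³ ε) t ∷ []) (s² a s³ a s² ε) b₋ 1F refl q p₋)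
          ... | inj₂ f = edge⇒linked p₋ 1F 3F
            (pass Q (sqr (s³ ε) f ∷ []) (s² a s³ a s² ε) (s³ a s b₋) refl q)

          path₁₃₃ : Joined (s³ a s³ a s ε)
          path₁₃₃ q with P.corner₂ p
          ... | inj₁ t = ⊥-elim (clash (tri (s² ε) t ∷ []) (s a s³ a s³ a s ε) ε 1F refl (Q.next q) p)
          ... | inj₂ f = edge⇒linked p 2F 2F
            (pass Q (sqr (s² ε) f ∷ []) (s a s³ a s³ a s ε) (s² a s² ε) refl (Q.next q))

          path₁₃₂ : Joined (s² a s³ a s ε)
          path₁₃₂ q with P.corner₂ p
          ... | inj₁ t = edge⇒linked p 2F 3F
            (pass Q (tri (s² ε) t ∷ []) (s² a s³ a s ε) (s³ a s² ε) refl q)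
          ... | inj₂ f = b , p , path₂ q (proj₁ (P.others₂ p f)) (proj₂ (Q.others₂ q
              (trans (sym (same-face [] 2 (s² s² a s³ a s ε) (s² ε) refl)) f)))

          path₁₂₂ : Joined (s² a s² a s ε)
          path₁₂₂ q with P.corner₁ p | Q.corner₃ q
          ... | inj₁ t | inj₁ u = ⊥-elim (clash
            (tri (s³ s² a s² a s ε) u ⁻¹ ∷ tri (s ε) t ⁻¹ ∷ []) (a s³ s² a s² a s ε) b′ 3F refl (Q.prev q) p′)
          ... | inj₁ t | inj₂ g = edge⇒linked p′ 1F 3F (pass Q
            (sqr (s³ s² a s² a s ε) g ⁻¹ ∷ tri (s ε) t ⁻¹ ∷ [])
            (a s³ s² a s² a s ε) (s³ a s b′) refl (Q.prev q))
          ... | inj₂ f | inj₁ u = edge⇒linked p′ 2F 2F (pass Q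
            (tri (s³ s² a s² a s ε) u ⁻¹ ∷ sqr (s ε) f ⁻¹ ∷ [])
            (a s³ s² a s² a s ε) (s² a s² b′) refl (Q.prev q))
          -- Two squares ahead force four triangles behind with a common apex. Five consecutive
          -- edges at the apex lead to the predecessor of `b`, to `b`, to the inner vertex, to `c`
          -- and to `φ` of `c`; as its degree is 4, the first and last coincide.
          ... | inj₂ f | inj₂ g = ⊥-elim (clash
            (tri (s c) (proj₁ (Q.others₃ q g)) ∷ tri (s² c) (proj₂ (Q.others₃ q g)) ∷
             tri (s² ε) (proj₁ (P.others₁ p f)) ∷ tri (s³ ε) (proj₂ (P.others₁ p f)) ∷ [])
            (s a c) b₋ 1F refl (Q.next q) p₋)
            where
            c = s² a s² a s ε

          path₂₂₃ : Joined (s³ a s² a s² ε)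
          path₂₂₃ q with P.corner₃ p | Q.corner₁ q
          ... | inj₁ t | inj₁ u = ⊥-elim (clash
            (tri (s s³ a s² a s² ε) u ∷ tri (s³ ε) t ∷ []) (s a s³ a s² a s² ε) b₋ 1F refl (Q.next q) p₋)
          ... | inj₁ t | inj₂ g = edge⇒linked p₋ 2F 2F (pass Q
            (sqr (s s³ a s² a s² ε) g ∷ tri (s³ ε) t ∷ [])
            (s a s³ a s² a s² ε) (s² a s² b₋) refl (Q.next q))
          ... | inj₂ f | inj₁ u = edge⇒linked p₋ 1F 3F (pass Q
            (tri (s s³ a s² a s² ε) u ∷ sqr (s³ ε) f ∷ [])
            (s a s³ a s² a s² ε) (s³ a s b₋) refl (Q.next q))
          ... | inj₂ f | inj₂ g = ⊥-elim (clash
            (tri (s³ c) (proj₂ (Q.others₁ q g)) ⁻¹ ∷ tri (s² c) (proj₁ (Q.others₁ q g)) ⁻¹ ∷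
             tri (s² ε) (proj₂ (P.others₃ p f)) ⁻¹ ∷ tri (s ε) (proj₁ (P.others₃ p f)) ⁻¹ ∷ [])
            (a s³ c) b′ 3F refl (Q.prev q) p′)
            where
            c = s³ a s² a s² ε

          path₁₂₃ : Joined (s³ a s² a s ε)
          path₁₂₃ q = go (P.corner₁ p) (Q.corner₁ q) (Q.corner₂ q)
            where
            c = s³ a s² a s ε
            c₁ = s² a s³ a s b′
            go : deg (σ b) ≡ 3 ⊎ deg (σ b) ≡ 4 →
                 deg (eval (s c) b) ≡ 3 ⊎ deg (eval (s c) b) ≡ 4 →
                 deg (eval (s² c) b) ≡ 3 ⊎ deg (eval (s² c) b) ≡ 4 → Linked
            go (inj₁ t) _ (inj₁ u) = edge⇒linked p′ 1F 2F
              (pass Q (tri (s² c) u ⁻¹ ∷ tri (s ε) t ⁻¹ ∷ []) c (s² a s b′) refl q)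
            go (inj₁ t) _ (inj₂ g) = _ , p′ , path₂ (pass Q rs c c₁ refl q)
              (proj₁ (P.others₂ p′
                (trans (sym (same-face (tri (s ε) t ∷ []) 2 (s² b′) (s² c) refl)) g)))
              (pass (λ d → deg d ≡ 3) rs (s³ c) (s³ c₁) refl (proj₂ (Q.others₂ q g)))
              where
              rs = sqr (s² c) g ⁻¹ ∷ tri (s ε) t ⁻¹ ∷ []
            go (inj₂ f) (inj₁ u) _ = edge⇒linked p 2F 3F
              (pass Q (tri (s c) u ∷ tri (s² ε) (proj₁ (P.others₁ p f)) ∷ [])
                (s a c) (s³ a s² ε) refl (Q.next q))
            -- The vertex behind the inner one has its four edges to the predecessor of `b`, to `b`,
            -- to the inner vertex and to `φ` of `c`. The triangle beyond the square joins the first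
            -- to the last.
            go (inj₂ f) (inj₂ g) _ = edge⇒linked p₋ 2F 3F
              (pass Q (tri (s² s a c) u₋ ∷ sqr (s c) g ∷ tri (s² ε) (proj₁ (P.others₁ p f)) ∷
                       tri (s³ ε) (proj₂ (P.others₁ p f)) ∷ [])
                (s a c) (s³ a s² b₋) refl (Q.next q))
              where
              u₋ = proj₂ (Q.others₃ (Q.next q)
                (trans (sym (same-face [] 1 (s³ s a c) (s c) refl)) g))

          path₂₂₂ : Joined (s² a s² a s² ε)
          path₂₂₂ q = go (Q.corner₃ q) (P.corner₂ p) (P.corner₃ p)
            where
            c = s² a s² a s² ε
            c′ = a s³ c
            c₁ = s² a s³ a s ε
            go : deg (eval (s³ c) b) ≡ 3 ⊎ deg (eval (s³ c) b) ≡ 4 →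
                 deg (iter σ 2 b) ≡ 3 ⊎ deg (iter σ 2 b) ≡ 4 →
                 deg (iter σ 3 b) ≡ 3 ⊎ deg (iter σ 3 b) ≡ 4 → Linked
            go (inj₁ u) (inj₁ t) _ = edge⇒linked p 1F 2F
              (pass Q (tri (s³ c) u ⁻¹ ∷ tri (s² ε) t ⁻¹ ∷ []) c′ (s² a s ε) refl (Q.prev q))
            go (inj₁ u) (inj₂ f) _ = b , p , path₂ (pass Q rs c′ c₁ refl (Q.prev q))
              (proj₁ (P.others₂ p f))
              (pass (λ d → deg d ≡ 3) rs (s³ c′) (s³ c₁) refl (proj₂ (Q.others₂ (Q.prev q)
                (trans (same-face (tri (s³ c) u ∷ []) 2 (s² ε) (s² c′) refl) f))))
              where
              rs = tri (s³ c) u ⁻¹ ∷ sqr (s² ε) f ⁻¹ ∷ []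
            go (inj₂ g) _ (inj₁ t) = edge⇒linked p₋ 2F 3F
              (pass Q (tri (s² c) (proj₂ (Q.others₃ q g)) ∷ tri (s³ ε) t ∷ [])
                c (s³ a s² b₋) refl q)
            -- The square ahead at `Q` is followed by a triangle, which joins the next vertex of `P`
            -- to the next vertex of `Q`.
            go (inj₂ g) _ (inj₂ f) = edge⇒linked p′ 1F 2F
              (pass Q (tri (s² c′) u′ ⁻¹ ∷ sqr (s³ c) g ⁻¹ ∷
                       tri (s² ε) (proj₂ (P.others₃ p f)) ⁻¹ ∷
                       tri (s ε) (proj₁ (P.others₃ p f)) ⁻¹ ∷ [])
                c′ (s² a s b′) refl (Q.prev q))
              where
              u′ = proj₁ (Q.others₁ (Q.prev q) (trans (same-face [] 1 (s³ c) (s c′) refl) g))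

      -- A path that backtracks or uses an edge of `P` or `Q` reduces to a single edge or to a
      -- contradiction; twelve genuine positions remain.
      path⇒linked : ∀ {b} → P b → ∀ n m l → Q (rot l (α (rot m (α (rot n b))))) → Linked
      path⇒linked {b} p 0F 0F l q = ⊥-elim (disjoint {b} l 0F (subst (λ d → Q (rot l d)) (α² b) q) p)
      path⇒linked p 0F 1F l q = edge⇒linked (P.next p) 0F l q
      path⇒linked p 0F 2F l q = edge⇒linked (P.next p) 1F l q
      path⇒linked p 0F 3F l q = edge⇒linked (P.next p) 2F l q
      path⇒linked p 3F m  l q = edge⇒linked (P.prev p) m l q
      path⇒linked {b} p 1F 0F l q = ⊥-elim (disjoint {σ b} l 3F
        (subst (λ d → Q (rot l d)) (α² _) q) (subst P (sym (σ⁴ b)) p))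
      path⇒linked {b} p 2F 0F l q = ⊥-elim (disjoint {iter σ 2 b} l 2F
        (subst (λ d → Q (rot l d)) (α² _) q) (subst P (sym (σ⁴ b)) p))
      path⇒linked p n 1F 0F q = edge⇒linked p n 2F (subst (λ d → Q (σ d)) (α² _) (Q.next q))
      path⇒linked p n 2F 0F q = edge⇒linked p n 3F (subst (λ d → Q (σ d)) (α² _) (Q.next q))
      path⇒linked p n 3F 0F q = edge⇒linked p n 0F
        (subst Q (trans (cong σ (α² _)) (σ⁴ _)) (Q.next q))
      path⇒linked p n m  1F q = edge⇒linked p n m
        (subst Q (trans (cong α (σ⁴ _)) (α² _)) (Q.prev q))
      path⇒linked p 1F 1F 2F q = AtPath.path₁₁₂ _ p q
      path⇒linked p 1F 1F 3F q = AtPath.path₁₁₃ _ p q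
      path⇒linked p 1F 2F 2F q = AtPath.path₁₂₂ _ p q
      path⇒linked p 1F 2F 3F q = AtPath.path₁₂₃ _ p q
      path⇒linked p 1F 3F 2F q = AtPath.path₁₃₂ _ p q
      path⇒linked p 1F 3F 3F q = AtPath.path₁₃₃ _ p q
      path⇒linked p 2F 1F 2F q = AtPath.path₂₁₂ _ p q
      path⇒linked p 2F 1F 3F q = AtPath.path₂₁₃ _ p q
      path⇒linked p 2F 2F 2F q = AtPath.path₂₂₂ _ p q
      path⇒linked p 2F 2F 3F q = AtPath.path₂₂₃ _ p q
      path⇒linked p 2F 3F 2F q = AtPath.path₂₃₂ _ p q
      path⇒linked p 2F 3F 3F q = AtPath.path₂₃₃ _ p q

      near²⇒linked : ∀ {v} → Neighbourhood.Near P v → Neighbourhood.Near Q v → Linked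
      near²⇒linked {v} (Neighbourhood.on (i , p)) n
        with Neighbourhood.near-iter Q (toℕ i) n
      ... | Neighbourhood.on (k , q)       = ⊥-elim (disjoint {rot i v} k 0F q p)
      ... | Neighbourhood.beside k (l , q) = edge⇒linked p k l q
      near²⇒linked {v} (Neighbourhood.beside i (j , p)) n
        with unrot j (α (rot i v))
      ... | j′ , eq with subst (Neighbourhood.Near Q) (trans (sym (α² _)) (cong α (sym eq)))
                           (Neighbourhood.near-iter Q (toℕ i) n)
      ... | Neighbourhood.on (k , q)       = edge⇒linked p j′ k q
      ... | Neighbourhood.beside k (l , q) = path⇒linked p j′ k l q

      -- The full turn around one face.

      sweep : ∀ {b} → P b → State b → ∀ n → P (iter φ n b) × State (iter φ n b)
      sweep p x zero    = p , x
      sweep p x (suc n) = let (p′ , x′) = sweep p x n in P.next p′ , proj₁ (step p′ x′)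

      linked⇒enclosed : Linked → ∀ {d} → P d → Enclosed (α (σ d)) × Enclosed (α (iter σ 2 d))
      linked⇒enclosed (b , p , x) {d} p′ with P.orbit p p′
      -- Since `orbit` supplies `suc n`, the dart has a predecessor in the sweep. Its own step
      -- encloses one outward neighbour, the step of the predecessor the other.
      ... | n , refl =
        proj₁ (proj₂ (step p′ (proj₂ (sweep p x (suc n))))) ,
        proj₂ (proj₂ (step (proj₁ (sweep p x n)) (proj₂ (sweep p x n))))

-- Iterates and minimal periods.

iter-+ : {A : Set} (f : A → A) (m n : ℕ) (x : A) → iter f (m + n) x ≡ iter f m (iter f n x)
iter-+ f zero    n x = refl
iter-+ f (suc m) n x = cong f (iter-+ f m n x)

iter-suc : {A : Set} (f : A → A) (n : ℕ) (x : A) → iter f n (f x) ≡ f (iter f n x)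
iter-suc f zero    x = refl
iter-suc f (suc n) x = cong f (iter-suc f n x)

iter-mod : {A : Set} (f : A → A) {x : A} {k : ℕ} → Period f x k →
           ∀ n → ∃ λ m → m < k × iter f m x ≡ iter f n x
iter-mod f (1≤k , _) zero = 0 , 1≤k , refl
iter-mod f {k = k} per@(1≤k , closes , _) (suc n) with iter-mod f per n
... | m , m<k , eq with suc m ≟ k
... | yes refl = 0 , 1≤k , trans (sym closes) (cong f eq)
... | no  m≢k  = suc m , ≤∧≢⇒< m<k m≢k , cong f eq

period-unique : {A : Set} {f : A → A} {x : A} {k l : ℕ} → Period f x k → Period f x l → k ≡ l
period-unique {k = k} {l} (1≤k , eqk , mink) (1≤l , eql , minl) with <-cmp k l
... | tri< k<l _ _ = ⊥-elim (minl k 1≤k k<l eqk)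
... | tri≈ _ eq _  = eq
... | tri> _ _ l<k = ⊥-elim (mink l 1≤l l<k eql)

period-next : {A : Set} {f : A → A} → (∀ {x y} → f x ≡ f y → x ≡ y) →
              ∀ {x k} → Period f x k → Period f (f x) k
period-next {f = f} inj {x} {k} (1≤k , eq , min) =
  1≤k , trans (iter-suc f k x) (cong f eq) ,
  λ n 1≤n n<k eq′ → min n 1≤n n<k (inj (trans (sym (iter-suc f n x)) eq′))

-- Curvature at a vertex of degree 4.

recip-anti : ∀ {m n} → m ≤ n → recip n ≤q recip m
recip-anti m≤n = *≤* (*-monoˡ-≤-nonNeg (+ 1) (+≤+ (s≤s (∸-monoˡ-≤ 1 m≤n))))

recip-+-anti : ∀ {m n x y} → m ≤ n → x ≤q y → recip n +q x ≤q recip m +q y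
recip-+-anti {m} {n} {x} {y} m≤n x≤y =
  ℚ.+-mono-≤ {recip n} {recip m} {x} {y} (recip-anti m≤n) x≤y

-- Arranged exactly as `Φ` unfolds at a vertex of degree 4.
curvature₄ : ℕ → ℕ → ℕ → ℕ → ℚᵘ
curvature₄ k l m n =
  (1ℚᵘ -q mkℚᵘ (+ 4) 1) +q (recip k +q (recip l +q (recip m +q (recip n +q 0ℚᵘ))))

curvature₄-anti : ∀ {k l m n k′ l′ m′ n′} → k ≤ k′ → l ≤ l′ → m ≤ m′ → n ≤ n′ →
                  curvature₄ k′ l′ m′ n′ ≤q curvature₄ k l m n
curvature₄-anti p q r t = ℚ.+-monoʳ-≤ (1ℚᵘ -q mkℚᵘ (+ 4) 1)
  (recip-+-anti p (recip-+-anti q (recip-+-anti r (recip-+-anti t (ℚ.≤-refl {0ℚᵘ})))))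

3≤n<5 : ∀ {n} → 3 ≤ n → ¬ (5 ≤ n) → n ≡ 3 ⊎ n ≡ 4
3≤n<5 {n} 3≤n n<5 with m≤n⇒m<n∨m≡n 3≤n
... | inj₂ eq  = inj₁ (sym eq)
... | inj₁ 4≤n with m≤n⇒m<n∨m≡n 4≤n
... | inj₂ eq  = inj₂ (sym eq)
... | inj₁ 5≤n = ⊥-elim (n<5 5≤n)

3≤n<4 : ∀ {n} → 3 ≤ n → ¬ (4 ≤ n) → n ≡ 3
3≤n<4 3≤n n<4 with m≤n⇒m<n∨m≡n 3≤n
... | inj₂ eq  = sym eq
... | inj₁ 4≤n = ⊥-elim (n<4 4≤n)

-- Application to the tessellation.

module FourRegularMap (T : Tessellation) (regular : FourRegular T) (nonNeg : NonNegCurv T) where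
  open Tessellation T

  σ⁴ : ∀ d → iter σ 4 d ≡ d
  σ⁴ d = subst (λ k → iter σ k d ≡ d) (regular d) (proj₁ (proj₂ (vdeg-per d)))

  open Rotation α σ α-invol σ⁴ hiding (φ)

  φ-injective : ∀ {d e} → φ d ≡ φ e → d ≡ e
  φ-injective {d} {e} eq = trans (sym (α-invol d)) (trans (cong α (trans (sym (σ⁴ (α d)))
    (trans (cong (iter σ 3) eq) (σ⁴ (α e))))) (α-invol e))

  -- `fdeg` is known only as a minimal period, and the injective map `φ` preserves such periods
  -- along its orbits.
  fdeg-φ : ∀ d → fdeg (φ d) ≡ fdeg d
  fdeg-φ d = period-unique (fdeg-per (φ d)) (period-next φ-injective (fdeg-per d))

  eval-φ^ : ∀ n d → eval (φ^ n) d ≡ iter φ n d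
  eval-φ^ zero    d = refl
  eval-φ^ (suc n) d = cong φ (eval-φ^ n d)

  open Degrees fdeg fdeg-φ
    (λ d → trans (eval-φ^ (fdeg d) d) (proj₁ (proj₂ (fdeg-per d))))

  sameFace-trans : ∀ {d e f} → SameFace d e → SameFace e f → SameFace d f
  sameFace-trans {d} (m , refl) (n , refl) = n + m , iter-+ φ n m d

  φ-sameFace : ∀ d → SameFace (φ d) d
  φ-sameFace d with fdeg d | fdeg-per d
  ... | suc k | _ , closes , _ = k , trans (iter-suc φ k d) closes

  sameFace-sym : ∀ {d e} → SameFace d e → SameFace e d
  sameFace-sym (zero , refl)  = 0 , refl
  sameFace-sym (suc n , refl) = sameFace-trans (φ-sameFace _) (sameFace-sym (n , refl))

  fdeg-sameFace : ∀ {d e} → SameFace d e → fdeg e ≡ fdeg d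
  fdeg-sameFace (zero , refl)  = refl
  fdeg-sameFace (suc n , refl) = trans (fdeg-φ _) (fdeg-sameFace (n , refl))

  corners≥ : ∀ d {k l m n} → k ≤ fdeg d → l ≤ fdeg (σ d) → m ≤ fdeg (iter σ 2 d) →
             n ≤ fdeg (iter σ 3 d) → 0ℚᵘ ≤q curvature₄ k l m n
  corners≥ d p q r t = ℚ.≤-trans
    (subst (λ k → 0ℚᵘ ≤q (1ℚᵘ -q mkℚᵘ (+ k) 1) +q cornerSum k d) (regular d) (nonNeg d))
    (curvature₄-anti p q r t)

  module AtLarge {d : D} (8≤ : 8 ≤ fdeg d) where

    <5₁ : ¬ (5 ≤ fdeg (σ d))
    -- Here 1/8 + 1/5 + 2/3 = 119/120 is just below 1; with 7 in place of 8 the sum would exceed 1.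
    <5₁ 5≤ = toWitnessFalse {a? = 0ℚᵘ ≤q? curvature₄ 8 5 3 3} _ (corners≥ d 8≤ 5≤ (fdeg≥3 _) (fdeg≥3 _))

    <5₂ : ¬ (5 ≤ fdeg (iter σ 2 d))
    <5₂ 5≤ = toWitnessFalse {a? = 0ℚᵘ ≤q? curvature₄ 8 3 5 3} _ (corners≥ d 8≤ (fdeg≥3 _) 5≤ (fdeg≥3 _))

    <5₃ : ¬ (5 ≤ fdeg (iter σ 3 d))
    <5₃ 5≤ = toWitnessFalse {a? = 0ℚᵘ ≤q? curvature₄ 8 3 3 5} _ (corners≥ d 8≤ (fdeg≥3 _) (fdeg≥3 _) 5≤)

    not₁₂ : 4 ≤ fdeg (σ d) → ¬ (4 ≤ fdeg (iter σ 2 d))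
    -- Now 1/8 + 1/4 + 1/4 + 1/3 = 23/24.
    not₁₂ p q = toWitnessFalse {a? = 0ℚᵘ ≤q? curvature₄ 8 4 4 3} _ (corners≥ d 8≤ p q (fdeg≥3 _))

    not₁₃ : 4 ≤ fdeg (σ d) → ¬ (4 ≤ fdeg (iter σ 3 d))
    not₁₃ p q = toWitnessFalse {a? = 0ℚᵘ ≤q? curvature₄ 8 4 3 4} _ (corners≥ d 8≤ p (fdeg≥3 _) q)

    not₂₃ : 4 ≤ fdeg (iter σ 2 d) → ¬ (4 ≤ fdeg (iter σ 3 d))
    not₂₃ p q = toWitnessFalse {a? = 0ℚᵘ ≤q? curvature₄ 8 3 4 4} _ (corners≥ d 8≤ (fdeg≥3 _) p q)

  on-large : ∀ {f d} → 8 ≤ fdeg f → SameFace f d → 8 ≤ fdeg d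
  on-large 8≤ p = subst (8 ≤_) (sym (fdeg-sameFace p)) 8≤

  largeFace : ∀ {f} → 8 ≤ fdeg f → LargeFace (SameFace f)
  largeFace {f} 8≤ = record
    { next = λ p → sameFace-trans p (1 , refl)
    ; prev = λ {d} p → sameFace-trans p (subst (λ e → SameFace e (α (iter σ 3 d)))
               (trans (cong σ (α-invol _)) (σ⁴ d)) (φ-sameFace _))
    ; orbit = λ {d} p q →
        let (n , eq) = sameFace-trans (φ-sameFace d) (sameFace-trans (sameFace-sym p) q)
        in n , trans (sym (iter-suc φ n d)) eq
    ; corner₁ = λ p → 3≤n<5 (fdeg≥3 _) (<5₁ (on-large 8≤ p))
    ; corner₂ = λ p → 3≤n<5 (fdeg≥3 _) (<5₂ (on-large 8≤ p))
    ; corner₃ = λ p → 3≤n<5 (fdeg≥3 _) (<5₃ (on-large 8≤ p))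
    ; others₁ = λ p eq → 3≤n<4 (fdeg≥3 _) (not₁₂ (on-large 8≤ p) (≤-reflexive (sym eq))) ,
                         3≤n<4 (fdeg≥3 _) (not₁₃ (on-large 8≤ p) (≤-reflexive (sym eq)))
    ; others₂ = λ p eq → 3≤n<4 (fdeg≥3 _) (λ q → not₁₂ (on-large 8≤ p) q (≤-reflexive (sym eq))) ,
                         3≤n<4 (fdeg≥3 _) (not₂₃ (on-large 8≤ p) (≤-reflexive (sym eq)))
    ; others₃ = λ p eq → 3≤n<4 (fdeg≥3 _) (λ q → not₁₃ (on-large 8≤ p) q (≤-reflexive (sym eq))) ,
                         3≤n<4 (fdeg≥3 _) (λ q → not₂₃ (on-large 8≤ p) q (≤-reflexive (sym eq)))
    }
    where open AtLarge

  large-disjoint : ∀ {f g} → 8 ≤ fdeg f → 8 ≤ fdeg g → ¬ SameFace f g →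
                   ∀ {d} i j → SameFace g (rot i d) → ¬ SameFace f (rot j d)
  large-disjoint {f} {g} 8≤f 8≤g f≢g {d} i j q p
    -- Rotating to the corner of the first face makes the second either that same corner or a
    -- neighbouring face of degree at least 5.
    with Neighbourhood.meets-iter (SameFace g) {d} (toℕ j) (i , q)
  ... | 0F , q′ = f≢g (sameFace-trans p (sameFace-sym q′))
  ... | 1F , q′ = <5₁ (on-large 8≤f p) (≤-trans (m≤n+m 5 3) (on-large 8≤g q′))
    where open AtLarge
  ... | 2F , q′ = <5₂ (on-large 8≤f p) (≤-trans (m≤n+m 5 3) (on-large 8≤g q′))
    where open AtLarge
  ... | 3F , q′ = <5₃ (on-large 8≤f p) (≤-trans (m≤n+m 5 3) (on-large 8≤g q′))
    where open AtLarge

  U₁⇒near : ∀ {f v} → InU₁ f v → Neighbourhood.Near (SameFace f) v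
  U₁⇒near {f} (inj₁ (x , p , n , eq)) =
    subst Near eq (near-iter n (on (0F , p)))
    where open Neighbourhood (SameFace f)
  U₁⇒near {f} (inj₂ (z , (x , p , n , eq) , m , eq′)) =
    subst Near eq′ (near-iter m (meets⇒near-α (subst Meets eq (meets-iter n (0F , p)))))
    where open Neighbourhood (SameFace f)

  faceList : D → List D
  faceList f = applyUpTo (λ n → iter φ n f) (fdeg f)

  ∈-faceList : ∀ {f d} → SameFace f d → d ∈ faceList f
  ∈-faceList {f} (n , eq) with iter-mod φ (fdeg-per f) n
  ... | m , m<k , eq′ = subst (_∈ faceList f) (trans eq′ eq) (∈-applyUpTo⁺ (λ n → iter φ n f) m<k)

  rotations : List D → List D
  rotations = cartesianProductWith rot (allFin 4)

  ∈-rotations : ∀ {l d} i → rot i d ∈ l → d ∈ rotations l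
  ∈-rotations {l} {d} i r with unrot i d
  ... | j , eq = subst (_∈ rotations l) eq (∈-cartesianProductWith⁺ rot (∈-allFin j) r)

  module _ {K : D → Set} where
    open Neighbourhood K

    nearList : List D → List D
    nearList l = rotations l ++ rotations (map α (rotations l))

    ∈-nearList : ∀ {l d} → (∀ {e} → K e → e ∈ l) → Near d → d ∈ nearList l
    ∈-nearList K⊆ (on (i , k)) = ∈-++⁺ˡ (∈-rotations i (K⊆ k))
    ∈-nearList {l} {d} K⊆ (beside i (j , k)) = ∈-++⁺ʳ (rotations l) (∈-rotations i
      (subst (_∈ map α (rotations l)) (α-invol (rot i d)) (∈-map⁺ α (∈-rotations j (K⊆ k)))))

    near-reach : (∀ {d} → Near d → Near (α d)) → ∀ {d e} → Reach M d e → Near d → Near e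
    near-reach near-α here     n = n
    near-reach near-α (viaα r) n = near-reach near-α r (near-α n)
    near-reach near-α (viaσ r) n = near-reach near-α r (near-σ n)

  near-disjoint : ∀ {f g} → 8 ≤ fdeg f → 8 ≤ fdeg g → ¬ SameFace f g → Infinite T →
    ∀ {v} → Neighbourhood.Near (SameFace f) v → ¬ Neighbourhood.Near (SameFace g) v
  near-disjoint {f} {g} 8≤f 8≤g f≢g infinite {v} n m =
    infinite (nearList {K} (faceList f ++ faceList g) , λ d → ∈-nearList K∈ (all-near d))
    where
    K : D → Set
    K d = SameFace f d ⊎ SameFace g d

    open Neighbourhood K
    -- `K` stays fixed while the faces exchange roles, so both sweeps enclose vertices in the same
    -- neighbourhood.
    module F = Strip {K = K} (largeFace 8≤f) (largeFace 8≤g) inj₁ inj₂ (large-disjoint 8≤f 8≤g f≢g)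
    module G = Strip {K = K} (largeFace 8≤g) (largeFace 8≤f) inj₂ inj₁
      (large-disjoint 8≤g 8≤f (λ p → f≢g (sameFace-sym p)))
    module LF = LargeFace (largeFace 8≤f)
    module LG = LargeFace (largeFace 8≤g)

    encl : ∀ {d} → K d → Enclosed (α (σ d)) × Enclosed (α (iter σ 2 d))
    encl = [ F.linked⇒enclosed (F.near²⇒linked n m) , G.linked⇒enclosed (G.near²⇒linked m n) ]′

    all-near : ∀ d → Near d
    all-near d = near-reach (near-α (⊎-map LF.next LG.next) (⊎-map LF.prev LG.prev) encl)
      (connected f d) (on (0F , inj₁ (0 , refl)))

    K∈ : ∀ {d} → K d → d ∈ faceList f ++ faceList g
    K∈ = [ (λ p → ∈-++⁺ˡ (∈-faceList p)) , (λ q → ∈-++⁺ʳ (faceList f) (∈-faceList q)) ]′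

theorem4p1 : (T : Tessellation) → Infinite T → FourRegular T → NonNegCurv T →
    ∀ σ₁ σ₂ → 8 ≤ Tessellation.fdeg T σ₁ → 8 ≤ Tessellation.fdeg T σ₂ →
    ¬ Tessellation.SameFace T σ₁ σ₂ →
    ∀ v → ¬ (Tessellation.InU₁ T σ₁ v × Tessellation.InU₁ T σ₂ v)
theorem4p1 T infinite regular nonNeg σ₁ σ₂ 8≤₁ 8≤₂ σ₁≢σ₂ v (u₁ , u₂) =
  near-disjoint 8≤₁ 8≤₂ σ₁≢σ₂ infinite (U₁⇒near u₁) (U₁⇒near u₂)
  where open FourRegularMap T regular nonNeg
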